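{- Let $S = \langle a, ah+d, ah+2d, \ldots, ah+kd\rangle$ be an extra-generalized arithmetical numerical semigroup, and write $a-1 = qk+r$ with $q,r\in\mathbb{Z}_{\ge 0}$ and $r<k$. (a) Each nonzero element $a_i \in \operatorname{Ap}(S;a)$ has the form $$a_i = x_i a h + ((x_i-1)k + y_i)d$$ for either $x_i \in [1,q]$ and $y_i\in[1,k]$, or $x_i = q+1$ and $y_i\in[1,r]$ (all integers). (b) For $a_i,a_j$ written as in (a), $a_i \prec a_j$ in $\operatorname{Ap}(S;a)$ if and only if $x_i<x_j$ and $y_i\ge y_j$. (c) For $a_i,a_j$ written as in (a), $a_j$ covers $a_i$ in $\operatorname{Ap}(S;a)$ if and only if $x_j = x_i+1$ and $y_i\ge y_j$.
   Context: A numerical semigroup is a subset $S \subseteq \mathbb{Z}_{\ge 0}$ containing $0$, closed under addition, with finite complement; $\langle n_1,\ldots,n_k\rangle$ denotes the set of all non-negative integer combinations of $n_1,\ldots,n_k$. For $m \in S$, $m>0$, the Apéry set is $\operatorname{Ap}(S;m) = \{n \in S : n-m\notin S\}$; it has exactly one element in each residue class modulo $m$. It is partially ordered by $b \preceq b'$ iff $b'-b\in S$ (the Apéry poset). In a poset, $p$ covers $p'$ if $p'\prec p$ and no $p''$ satisfies $p'\prec p''\prec p$. An extra-generalized arithmetical numerical semigroup is a numerical semigroup of the form $S = \langle a, ah+d, ah+2d,\ldots, ah+kd\rangle$ with $a,h,k \in \mathbb{Z}_{\ge 1}$ and $d\in\mathbb{Z}$ such that $k<a$, $\gcd(a,d)=1$,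 and $ah+kd>a$. Note $d$ may be negative.
   Formalization: Added hypothesis: a, ah+d, …, ah+kd are the minimal generators of S (automatic for d>0). Without it the claim fails: for a=5, h=10, k=3, d=−14, the Apéry element 16 does not have the form in (a). -}

module Defs where

open import Data.Fin.Base using (zero; suc; toℕ)
open import Data.Integer.Base
  using (ℤ; +_; 0ℤ; 1ℤ; _+_; _-_; _*_; _≤_; _<_)
open import Data.Integer.GCD using (gcd)
open import Data.Integer.Properties using (+-0-monoid)
import Data.List.Membership.Propositional as List
open import Data.Nat.Base as ℕ using (ℕ)
open import Data.Product.Base using (_×_; ∃; ∃-syntax)
open import Data.Sum.Base using (_⊎_)
open import Data.Vec.Functional using (Vector; removeAt)
open import Level using (0ℓ)
open import Relation.Binary.Core using (Rel)
import Relation.Binary.Construct.NonStrictToStrict as NonStrictToStrict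
open import Relation.Binary.PropositionalEquality.Core using (_≡_)
open import Relation.Nullary.Negation.Core using (¬_)
open import Relation.Unary using (Pred; _∈_; _∉_; _≐_)

open import Algebra.Properties.Monoid.Sum +-0-monoid using (sum)

-- Subsets of ℤ≥0 are predicates on ℤ, so that the differences n - m and
-- b′ - b below are genuine, possibly negative, integers.

record IsNumericalSemigroup (S : Pred ℤ 0ℓ) : Set where
  field
    nonNegative      : ∀ {n} → n ∈ S → 0ℤ ≤ n
    0∈               : 0ℤ ∈ S
    +-closed         : ∀ {m n} → m ∈ S → n ∈ S → m + n ∈ S
    finiteComplement : ∃[ gaps ] (∀ n → 0ℤ ≤ n → n ∉ S → n List.∈ gaps)

⟨_⟩ : ∀ {n} → Vector ℤ n → Pred ℤ 0ℓ
⟨_⟩ {n} g s = ∃ λ (c : Vector ℕ n) → s ≡ sum (λ i → + c i * g i)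

-- No generator is a combination of the others.  For generators of the shape
-- a, ah + d, …, ah + kd below this is automatic when d > 0 but not when d < 0:
-- a = 5, h = 10, k = 3, d = -14 gives 5, 36, 22, 8, where 36 = 4·5 + 2·8, and
-- 16 ∈ Ap S 5 is then not of the form  value 5 10 3 -14 x y  with (x , y) in
-- range.
AreMinimalGenerators : ∀ {n} → Vector ℤ (ℕ.suc n) → Set
AreMinimalGenerators g = ∀ i → g i ∉ ⟨ removeAt g i ⟩

Ap : Pred ℤ 0ℓ → ℤ → Pred ℤ 0ℓ
Ap S m n = n ∈ S × n - m ∉ S

infix 4 _⊢_≼_ _⊢_≺_

_⊢_≼_ : Pred ℤ 0ℓ → Rel ℤ 0ℓ
S ⊢ b ≼ b′ = b′ - b ∈ S

_⊢_≺_ : Pred ℤ 0ℓ → Rel ℤ 0ℓ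
S ⊢ b ≺ b′ = NonStrictToStrict._<_ _≡_ (S ⊢_≼_) b b′

-- p covers p′ in the poset with underlying set P and strict order _⊏_.
Covers : {A : Set} → Pred A 0ℓ → Rel A 0ℓ → Rel A 0ℓ
Covers P _⊏_ p p′ = p′ ⊏ p × ¬ (∃[ p″ ] p″ ∈ P × p′ ⊏ p″ × p″ ⊏ p)

-- a , ah + d , ah + 2d , … , ah + kd
generators : (a h k : ℕ) (d : ℤ) → Vector ℤ (ℕ.suc k)
generators a h k d zero    = + a
generators a h k d (suc i) = + a * + h + + ℕ.suc (toℕ i) * d

record IsExtraGeneralizedArithmetical
         (S : Pred ℤ 0ℓ) (a h k : ℕ) (d : ℤ) : Set where
  field
    isNumericalSemigroup : IsNumericalSemigroup S
    generated            : S ≐ ⟨ generators a h k d ⟩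
    1≤a                  : 1 ℕ.≤ a
    1≤h                  : 1 ℕ.≤ h
    1≤k                  : 1 ℕ.≤ k
    k<a                  : k ℕ.< a
    coprime              : gcd (+ a) d ≡ 1ℤ
    a<ah+kd              : + a < + a * + h + + k * d

InRange : (k q r x y : ℕ) → Set
InRange k q r x y =
    ((1 ℕ.≤ x × x ℕ.≤ q) × (1 ℕ.≤ y × y ℕ.≤ k))
  ⊎ (x ≡ q ℕ.+ 1 × (1 ℕ.≤ y × y ℕ.≤ r))

-- The subtraction x - 1 is taken in ℤ.
value : (a h k : ℕ) (d : ℤ) (x y : ℕ) → ℤ
value a h k d x y = + x * + a * + h + ((+ x - 1ℤ) * + k + + y) * d

{-# OPTIONS --safe #-}
module Submission where

-- S consists of the integers ca + n(ah) + td with n ≤ t ≤ nk, and an element of Ap(S;a) has c = 0.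
-- It also has (n-1)k < t, since otherwise one copy of ah splits off. Finally t < a: if ek ≤ a
-- and eh + d > 0, which minimality of the generators provides for e = q or e = q + 1, then for
-- t ≥ a one can split off ad and e′ ≥ e copies of ah, a positive multiple of a. As gcd(a,d) = 1,
-- t < a determines n and t, so that x = n and y = t - (n-1)k are coordinates on Ap(S;a).
-- They turn a_j = a_i + (an element of S) into x_j = x_i + n, t_j = t_i + t with n ≤ t ≤ nk.

open import Algebra.Bundles using (AbelianGroup)
import Algebra.Properties.CommutativeMonoid.Sum as Sum
import Algebra.Properties.Group as Group
open import Data.Fin.Base using (Fin; zero; suc; toℕ; fromℕ<; punchOut)
open import Data.Fin.Properties using (toℕ-fromℕ<; toℕ<n; punchIn-punchOut)
open import Data.Integer.Base as ℤ using (ℤ; +_; 0ℤ; 1ℤ; ∣_∣)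
open import Data.Integer.Coprimality using (coprime-divisor)
import Data.Integer.Divisibility.Signed as Signed
import Data.Integer.Properties as ℤ
open import Data.Integer.GCD using (gcd)
open import Data.Integer.Tactic.RingSolver using (solve-∀)
open import Data.Nat.Base using (ℕ; zero; suc; _+_; _*_; _∸_; _<_; _≤_; _≥_; _⊓_; z≤n; s≤s; >-nonZero)
open import Data.Nat.Coprimality using (gcd≡1⇒coprime)
open import Data.Nat.Divisibility using (>⇒∤)
open import Data.Nat.Properties
import Data.Nat.Tactic.RingSolver as ℕ-Solver
open import Data.Product.Base using (_×_; _,_; ∃-syntax; proj₁; proj₂)
open import Data.Sum.Base using (inj₁; inj₂)
open import Data.Vec.Functional using (Vector; removeAt; _∷_; replicate; tail)
open import Defs
open import Function.Base using (_∘_)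
open import Function.Bundles using (_⇔_; mk⇔)
open import Level using (0ℓ)
open import Relation.Binary.Definitions using (tri<; tri≈; tri>)
open import Relation.Binary.PropositionalEquality
  using (_≡_; _≢_; refl; sym; trans; cong; cong₂; subst; subst₂; module ≡-Reasoning)
open import Relation.Nullary.Decidable using (yes; no)
open import Relation.Nullary.Negation using (contradiction; ¬_)
open import Relation.Unary using (Pred; _∈_; _∉_)

open Sum ℤ.+-0-commutativeMonoid using (sum; sum-cong-≗; sum-replicate-zero; ∑-distrib-+)

-- Spans of integer vectors with natural coefficients

module Span {n} (v : Vector ℤ n) where

  0∈span : 0ℤ ∈ ⟨ v ⟩
  0∈span = replicate n 0 , sym (sum-replicate-zero n)

  span-+-closed : ∀ {s t} → s ∈ ⟨ v ⟩ → t ∈ ⟨ v ⟩ → s ℤ.+ t ∈ ⟨ v ⟩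
  span-+-closed (c , refl) (c′ , refl) = (λ i → c i + c′ i) ,
    trans (sym (∑-distrib-+ (λ i → + c i ℤ.* v i) (λ i → + c′ i ℤ.* v i)))
          (sum-cong-≗ {n} (λ i → sym (ℤ.*-distribʳ-+ (v i) (+ c i) (+ c′ i))))

generator∈span : ∀ {n} (v : Vector ℤ n) i → v i ∈ ⟨ v ⟩
generator∈span {suc n} v zero = 1 ∷ replicate n 0 ,
  sym (trans (cong₂ ℤ._+_ (ℤ.*-identityˡ (v zero)) (sum-replicate-zero n)) (ℤ.+-identityʳ _))
generator∈span {suc n} v (suc i) with c , eq ← generator∈span (tail v) i =
  0 ∷ c , trans eq (sym (ℤ.+-identityˡ _))

generator∈span-removeAt : ∀ {n} (v : Vector ℤ (suc n)) {i j} → i ≢ j →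
                          v j ∈ ⟨ removeAt v i ⟩
generator∈span-removeAt v {i} i≢j =
  subst (λ l → v l ∈ ⟨ removeAt v i ⟩) (punchIn-punchOut i≢j)
        (generator∈span (removeAt v i) (punchOut i≢j))

-- Sums of n indices from [1, k] and the combinations they give

Balanced : (k n t : ℕ) → Set
Balanced k n t = n ≤ t × t ≤ n * k

balanced-+ : ∀ {k n t n′ t′} → Balanced k n t → Balanced k n′ t′ →
             Balanced k (n + n′) (t + t′)
balanced-+ {k} {n} {n′ = n′} (n≤t , t≤nk) (n′≤t′ , t′≤n′k) =
  +-mono-≤ n≤t n′≤t′ ,
  ≤-trans (+-mono-≤ t≤nk t′≤n′k) (≤-reflexive (sym (*-distribʳ-+ k n n′)))

-- A balanced combination is a sum of n generators ah + id whose indices i add up to t.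
combination : (a h : ℕ) (d : ℤ) (n t : ℕ) → ℤ
combination a h d n t = + n ℤ.* (+ a ℤ.* + h) ℤ.+ + t ℤ.* d

combination-+ : ∀ a h d n t n′ t′ → combination a h d (n + n′) (t + t′) ≡
                combination a h d n t ℤ.+ combination a h d n′ t′
combination-+ a h d n t n′ t′ = identity (+ n) (+ t) (+ n′) (+ t′) (+ a ℤ.* + h) d
  where
  identity : ∀ n t n′ t′ c d → (n ℤ.+ n′) ℤ.* c ℤ.+ (t ℤ.+ t′) ℤ.* d ≡
             (n ℤ.* c ℤ.+ t ℤ.* d) ℤ.+ (n′ ℤ.* c ℤ.+ t′ ℤ.* d)
  identity = solve-∀

balanced-* : ∀ {k i} c → 1 ≤ i → i ≤ k → Balanced k c (c * i)
balanced-* c 1≤i i≤k =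
  ≤-trans (≤-reflexive (sym (*-identityʳ c))) (*-monoʳ-≤ c 1≤i) , *-monoʳ-≤ c i≤k

-- Passes from the coordinates (x , y) to n = x and t = (x - 1)k + y. Writing x as `suc m` turns the
-- integer x - 1 into the natural number m.
value≡combination : ∀ a h k d m y → value a h k d (suc m) y ≡ combination a h d (suc m) (m * k + y)
value≡combination a h k d m y = trans
  (cong (λ z → + suc m ℤ.* + a ℤ.* + h ℤ.+ (z ℤ.+ + y) ℤ.* d) (sym (ℤ.pos-* m k)))
  (cong (ℤ._+ (+ (m * k + y)) ℤ.* d) (ℤ.*-assoc (+ suc m) (+ a) (+ h)))

-- The indices are an arbitrary bounded `f`, not `suc ∘ toℕ`, because the induction drops the first
-- generator and the remaining indices do not start at 1 again.
sum-is-combination : ∀ a h k d {m} (c f : Fin m → ℕ) → (∀ i → 1 ≤ f i × f i ≤ k) →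
  ∃[ n ] ∃[ t ] (Balanced k n t ×
    sum (λ i → + c i ℤ.* (+ a ℤ.* + h ℤ.+ + f i ℤ.* d)) ≡ combination a h d n t)
sum-is-combination a h k d {zero} c f bound = 0 , 0 , (z≤n , z≤n) , refl
sum-is-combination a h k d {suc m} c f bound
  with n , t , balanced , eq ← sum-is-combination a h k d (c ∘ suc) (f ∘ suc) (bound ∘ suc) =
  c₀ + n , c₀ * f₀ + t ,
  balanced-+ (balanced-* c₀ (proj₁ (bound zero)) (proj₂ (bound zero))) balanced ,
  trans (cong₂ ℤ._+_ head-eq eq) (sym (combination-+ a h d c₀ (c₀ * f₀) n t))
  where
  c₀ = c zero
  f₀ = f zero
  identity : ∀ c f b d → c ℤ.* (b ℤ.+ f ℤ.* d) ≡ c ℤ.* b ℤ.+ c ℤ.* f ℤ.* d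
  identity = solve-∀
  head-eq : + c₀ ℤ.* (+ a ℤ.* + h ℤ.+ + f₀ ℤ.* d) ≡ combination a h d c₀ (c₀ * f₀)
  head-eq = trans (identity (+ c₀) (+ f₀) (+ a ℤ.* + h) d)
    (cong (λ z → + c₀ ℤ.* (+ a ℤ.* + h) ℤ.+ z ℤ.* d) (sym (ℤ.pos-* c₀ f₀)))

combination-1 : ∀ a h d i → combination a h d 1 i ≡ + a ℤ.* + h ℤ.+ + i ℤ.* d
combination-1 a h d i = cong (ℤ._+ + i ℤ.* d) (ℤ.*-identityˡ (+ a ℤ.* + h))

-- Balanced combinations inside a submonoid of ℤ

module Submonoid {P : Pred ℤ 0ℓ} (0∈P : 0ℤ ∈ P)
                 (+-closed : ∀ {s t} → s ∈ P → t ∈ P → s ℤ.+ t ∈ P) where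

  multiple∈ : ∀ n {s} → s ∈ P → + n ℤ.* s ∈ P
  multiple∈ zero    s∈P = 0∈P
  multiple∈ (suc n) {s} s∈P =
    subst P (sym (ℤ.suc-* (+ n) s)) (+-closed s∈P (multiple∈ n s∈P))

  combination-suc∈ : ∀ a h d i n u → + a ℤ.* + h ℤ.+ + i ℤ.* d ∈ P → combination a h d n u ∈ P →
                     combination a h d (suc n) (i + u) ∈ P
  combination-suc∈ a h d i n u g∈P combination∈P = subst P
    (trans (cong (ℤ._+ combination a h d n u) (sym (combination-1 a h d i)))
           (sym (combination-+ a h d 1 i n u)))
    (+-closed g∈P combination∈P)

  -- Greedy induction on the number of generators: split off one of index min(t - n, k). If this is
  -- t - n, the other n generators all have index 1; if it is k, then t - k is still at least n.
  combination∈ : ∀ a h k d → (∀ {i} → 1 ≤ i → i ≤ k → + a ℤ.* + h ℤ.+ + i ℤ.* d ∈ P) →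
                 ∀ n {t} → Balanced k n t → combination a h d n t ∈ P
  combination∈ a h k d g∈P zero (_ , z≤n) = 0∈P
  combination∈ a h k d g∈P (suc n) {t} (n<t , t≤k+nk) with ≤-total (t ∸ n) k
  ... | inj₁ t∸n≤k = subst (λ u → combination a h d (suc n) u ∈ P) (m∸n+n≡m (<⇒≤ n<t))
    (combination-suc∈ a h d (t ∸ n) n n (g∈P (m<n⇒0<n∸m n<t) t∸n≤k)
      (combination∈ a h k d g∈P n (≤-refl , n≤nk)))
    where
    n≤nk : n ≤ n * k
    n≤nk = ≤-trans (≤-reflexive (sym (*-identityʳ n)))
                   (*-monoʳ-≤ n (≤-trans (m<n⇒0<n∸m n<t) t∸n≤k))
  ... | inj₂ k≤t∸n = subst (λ u → combination a h d (suc n) u ∈ P) (m+[n∸m]≡n k≤t)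
    (combination-suc∈ a h d k n (t ∸ k) (g∈P 1≤k ≤-refl)
      (combination∈ a h k d g∈P n (n≤t∸k , m≤n+o⇒m∸n≤o t k t≤k+nk)))
    where
    k≤t : k ≤ t
    k≤t = ≤-trans k≤t∸n (m∸n≤m t n)
    n≤t∸k : n ≤ t ∸ k
    n≤t∸k = m+n≤o⇒m≤o∸n n (≤-trans (+-monoʳ-≤ n k≤t∸n) (≤-reflexive (m+[n∸m]≡n (<⇒≤ n<t))))
    1≤k : 1 ≤ k
    1≤k = n≢0⇒n>0 λ where
      refl → <⇒≱ n<t (≤-trans t≤k+nk (≤-trans (≤-reflexive (*-zeroʳ n)) z≤n))

-- The bound that minimality of the generators provides

generators-suc : ∀ a h {k} d {j} (j<k : j < k) →
  generators a h k d (suc (fromℕ< j<k)) ≡ + a ℤ.* + h ℤ.+ + suc j ℤ.* d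
generators-suc a h d j<k =
  cong (λ j → + a ℤ.* + h ℤ.+ + suc j ℤ.* d) (toℕ-fromℕ< j<k)

nonNegative⇒natural : ∀ {z} → 0ℤ ℤ.≤ z → ∃[ n ] z ≡ + n
nonNegative⇒natural {z} 0≤z = ∣ z ∣ , sym (ℤ.0≤i⇒+∣i∣≡i 0≤z)

-- If k ∣ a the bound is ah + kd > 0. Otherwise, with i = k - r - 1, it follows from
-- (q + 1)(ah + kd) = (ah + id) + (qh + d)a, as ah + id must not be redundant.
∃-exchange : ∀ a h k d q r → suc r ≤ k → a ≡ suc (q * k + r) →
  0ℤ ℤ.< + a ℤ.* + h ℤ.+ + k ℤ.* d → AreMinimalGenerators (generators a h k d) →
  ∃[ e ] (e * k ≤ a × 0ℤ ℤ.< + e ℤ.* + h ℤ.+ d)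
∃-exchange a h k d q r r<k a≡ 0<ah+kd minimal with m≤n⇒m<n∨m≡n r<k
-- Here r + 1 = k, so a = (q + 1)k and ah + kd = k((q + 1)h + d), from which k is cancelled.
... | inj₂ refl = suc q , ≤-reflexive (sym a≡k[q+1]) ,
  ℤ.*-cancelˡ-<-nonNeg (+ k) (subst₂ ℤ._<_ (sym (ℤ.*-zeroʳ (+ k)))
    (trans (cong (λ z → z ℤ.* + h ℤ.+ + k ℤ.* d) (trans (cong +_ a≡k[q+1]) (ℤ.pos-* (suc q) k)))
           (identity (+ suc q) (+ k) (+ h) d))
    0<ah+kd)
  where
  a≡k[q+1] : a ≡ suc q * k
  a≡k[q+1] = trans a≡ (trans (sym (+-suc (q * k) r)) (+-comm (q * k) (suc r)))
  identity : ∀ q k h d → q ℤ.* k ℤ.* h ℤ.+ k ℤ.* d ≡ k ℤ.* (q ℤ.* h ℤ.+ d)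
  identity = solve-∀
... | inj₁ r+1<k with m≤n⇒∃[o]m+o≡n r+1<k
-- Now k = r + 2 + j, so the index i = k - r - 1 is `suc j`, strictly below k.
...   | j , refl with 0ℤ ℤ.<? + q ℤ.* + h ℤ.+ d
...     | yes 0<qh+d = q , ≤-trans (m≤n⇒m≤1+n (m≤m+n (q * k) r)) (≤-reflexive (sym a≡)) , 0<qh+d
-- With `c` = -(qh + d) ≥ 0, the element ah + id is q + 1 copies of ah + kd plus `c` copies of a.
...     | no  0≮qh+d = contradiction
          (subst (_∈ ⟨ removeAt g index ⟩) relation
            (Span.span-+-closed (removeAt g index)
              (multiple∈ (suc q) (subst (_∈ ⟨ removeAt g index ⟩) (generators-suc a h d k-1<k)
                (generator∈span-removeAt g index≢last)))
              (multiple∈ c (generator∈span-removeAt g {index} {zero} λ ()))))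
          (minimal index)
  where
  g = generators a h k d
  j<k : j < k
  j<k = s≤s (m≤n⇒m≤1+n (m≤n+m j r))
  k-1<k : suc (r + j) < k
  k-1<k = ≤-refl
  index last : Fin (suc k)
  index = suc (fromℕ< j<k)
  last = suc (fromℕ< k-1<k)
  index≢last : index ≢ last
  index≢last eq = <⇒≢ (s≤s (m≤n+m j r))
    (trans (sym (toℕ-fromℕ< j<k)) (trans (cong (λ i → toℕ i ∸ 1) eq) (toℕ-fromℕ< k-1<k)))
  open Submonoid {⟨ removeAt g index ⟩} (Span.0∈span (removeAt g index)) (Span.span-+-closed (removeAt g index))
  natural : ∃[ c ] ℤ.- (+ q ℤ.* + h ℤ.+ d) ≡ + c
  natural = nonNegative⇒natural (ℤ.neg-mono-≤ (ℤ.≮⇒≥ 0≮qh+d))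
  c = proj₁ natural
  -- This makes the multiples of d on the two sides of `relation` agree.
  a+i≡[q+1]k : a + suc j ≡ suc q * k
  a+i≡[q+1]k = trans (cong (_+ suc j) a≡) (ℕ-identity (q * k) r j)
    where
    ℕ-identity : ∀ m r j → suc (m + r) + suc j ≡ suc (suc (r + j)) + m
    ℕ-identity = ℕ-Solver.solve-∀
  identity : ∀ a b d q h i → (1ℤ ℤ.+ q) ℤ.* (a ℤ.* h ℤ.+ b ℤ.* d) ℤ.+ ℤ.- (q ℤ.* h ℤ.+ d) ℤ.* a ≡
             (a ℤ.* h ℤ.+ i ℤ.* d) ℤ.+ ((1ℤ ℤ.+ q) ℤ.* b ℤ.- (a ℤ.+ i)) ℤ.* d
  identity = solve-∀
  relation : + suc q ℤ.* (+ a ℤ.* + h ℤ.+ + k ℤ.* d) ℤ.+ + c ℤ.* + a ≡ g index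
  relation = begin
    + suc q ℤ.* (+ a ℤ.* + h ℤ.+ + k ℤ.* d) ℤ.+ + c ℤ.* + a
      ≡⟨ cong (λ z → + suc q ℤ.* (+ a ℤ.* + h ℤ.+ + k ℤ.* d) ℤ.+ z ℤ.* + a) (proj₂ natural) ⟨
    + suc q ℤ.* (+ a ℤ.* + h ℤ.+ + k ℤ.* d) ℤ.+ ℤ.- (+ q ℤ.* + h ℤ.+ d) ℤ.* + a
      ≡⟨ identity (+ a) (+ k) d (+ q) (+ h) (+ suc j) ⟩
    (+ a ℤ.* + h ℤ.+ + suc j ℤ.* d) ℤ.+ (+ suc q ℤ.* + k ℤ.- + (a + suc j)) ℤ.* d
      ≡⟨ cong (λ z → (+ a ℤ.* + h ℤ.+ + suc j ℤ.* d) ℤ.+ z ℤ.* d)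
           (ℤ.i≡j⇒i-j≡0 (trans (sym (ℤ.pos-* (suc q) k)) (cong +_ (sym a+i≡[q+1]k)))) ⟩
    (+ a ℤ.* + h ℤ.+ + suc j ℤ.* d) ℤ.+ 0ℤ
      ≡⟨ ℤ.+-identityʳ _ ⟩
    + a ℤ.* + h ℤ.+ + suc j ℤ.* d
      ≡⟨ generators-suc a h d j<k ⟨
    g index ∎
    where open ≡-Reasoning

-- Uniqueness and range of the coordinates

module _ {a h : ℕ} {d : ℤ} (1≤a : 1 ≤ a) (1≤h : 1 ≤ h) (coprime : gcd (+ a) d ≡ 1ℤ) where

  private
    -- Modulo a a combination is td. As d is invertible modulo a, equal values force a to divide t′
    -- - t, which is less than a and hence 0.
    index-unique-≤ : ∀ n n′ {t t′} → t ≤ t′ → t′ < a →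
                     combination a h d n t ≡ combination a h d n′ t′ → t ≡ t′
    index-unique-≤ n n′ {t} {t′} t≤t′ t′<a eq with m≤n⇒∃[o]m+o≡n t≤t′
    ... | zero  , t+0≡t′ = trans (sym (+-identityʳ t)) t+0≡t′
    ... | suc s , refl = contradiction
      (coprime-divisor (+ a) d (+ suc s) (gcd≡1⇒coprime (ℤ.+-injective coprime))
        (Signed.∣⇒∣ᵤ (Signed.divides (+ n ℤ.* + h ℤ.- + n′ ℤ.* + h) multiple)))
      (>⇒∤ (≤-<-trans (m≤n+m (suc s) t) t′<a))
      where
      identity : ∀ a h d n t n′ s → d ℤ.* s ≡ (n ℤ.* h ℤ.- n′ ℤ.* h) ℤ.* a ℤ.+
        ((n′ ℤ.* (a ℤ.* h) ℤ.+ (t ℤ.+ s) ℤ.* d) ℤ.- (n ℤ.* (a ℤ.* h) ℤ.+ t ℤ.* d))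
      identity = solve-∀
      multiple : d ℤ.* + suc s ≡ (+ n ℤ.* + h ℤ.- + n′ ℤ.* + h) ℤ.* + a
      multiple = trans (identity (+ a) (+ h) d (+ n) (+ t) (+ n′) (+ suc s))
        (trans (cong (λ z → (+ n ℤ.* + h ℤ.- + n′ ℤ.* + h) ℤ.* + a ℤ.+ z) (ℤ.i≡j⇒i-j≡0 (sym eq)))
               (ℤ.+-identityʳ _))

    index-unique : ∀ n n′ {t t′} → t < a → t′ < a →
                   combination a h d n t ≡ combination a h d n′ t′ → t ≡ t′
    index-unique n n′ {t} {t′} t<a t′<a eq with ≤-total t t′
    ... | inj₁ t≤t′ = index-unique-≤ n n′ t≤t′ t′<a eq
    ... | inj₂ t′≤t = sym (index-unique-≤ n′ n t′≤t t<a (sym eq))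

  -- Once the indices t agree, td cancels and then the nonzero factor ah.
  combination-injective : ∀ n n′ {t t′} → t < a → t′ < a →
    combination a h d n t ≡ combination a h d n′ t′ → n ≡ n′ × t ≡ t′
  combination-injective n n′ {t} t<a t′<a eq with index-unique n n′ t<a t′<a eq
  ... | refl = ℤ.+-injective (ℤ.*-cancelʳ-≡ (+ n) (+ n′) (+ (a * h)) ah-eq) , refl
    where
    instance
      ah≢0 = m*n≢0 a h {{>-nonZero 1≤a}} {{>-nonZero 1≤h}}
    ah-eq : + n ℤ.* + (a * h) ≡ + n′ ℤ.* + (a * h)
    ah-eq = subst (λ z → + n ℤ.* z ≡ + n′ ℤ.* z) (sym (ℤ.pos-* a h)) (Group.∙-cancelʳ (AbelianGroup.group ℤ.+-0-abelianGroup) (+ t ℤ.* d) _ _ eq)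

-- Both alternatives of the range amount to x ≥ 1, 1 ≤ y ≤ k and (x - 1)k + y ≤ qk + r = a - 1. For
-- x ≤ q the last bound is automatic; for x = q + 1 it reads y ≤ r.
InRange⇒ : ∀ {a k q r x y} → a ≡ suc (q * k + r) → r < k → InRange k q r x y →
           ∃[ m ] (x ≡ suc m × 1 ≤ y × y ≤ k × m * k + y < a)
InRange⇒ {k = k} {q} {r} refl r<k (inj₁ ((s≤s {n = m} z≤n , m<q) , 1≤y , y≤k)) =
  m , refl , 1≤y , y≤k , s≤s (≤-trans (+-monoʳ-≤ (m * k) y≤k)
    (≤-trans (≤-reflexive (+-comm (m * k) k)) (≤-trans (*-monoˡ-≤ k m<q) (m≤m+n (q * k) r))))
InRange⇒ {k = k} {q} refl r<k (inj₂ (refl , 1≤y , y≤r)) =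
  q , +-comm q 1 , 1≤y , ≤-trans y≤r (<⇒≤ r<k) , s≤s (+-monoʳ-≤ (q * k) y≤r)

InRange⇐ : ∀ {a k q r m y} → a ≡ suc (q * k + r) → r < k →
           1 ≤ y → y ≤ k → m * k + y < a → InRange k q r (suc m) y
InRange⇐ {k = k} {q} {r} {m} {y} refl r<k 1≤y y≤k (s≤s mk+y≤qk+r) with <-cmp m q
... | tri< m<q _ _ = inj₁ ((s≤s z≤n , m<q) , 1≤y , y≤k)
... | tri≈ _ refl _ = inj₂ (+-comm 1 q , 1≤y , +-cancelˡ-≤ (q * k) y r mk+y≤qk+r)
... | tri> _ _ q<m = contradiction mk+y≤qk+r (<⇒≱ (begin-strict
  q * k + r  <⟨ +-monoʳ-< (q * k) r<k ⟩
  q * k + k  ≡⟨ +-comm (q * k) k ⟩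
  suc q * k  ≤⟨ *-monoˡ-≤ k q<m ⟩
  m * k      ≤⟨ m≤m+n (m * k) y ⟩
  m * k + y  ∎))
  where open ≤-Reasoning

-- The Apéry set in coordinates

module ApéryPoset
  (S : Pred ℤ 0ℓ) (a h k : ℕ) (d : ℤ) (extra : IsExtraGeneralizedArithmetical S a h k d)
  (minimal : AreMinimalGenerators (generators a h k d))
  (q r : ℕ) (a≡ : a ≡ suc (q * k + r)) (r<k : r < k) where

  open IsExtraGeneralizedArithmetical extra
  open IsNumericalSemigroup isNumericalSemigroup
  open Submonoid {S} 0∈ +-closed

  private
    instance
      k≢0 = >-nonZero 1≤k

  a∈S : + a ∈ S
  a∈S = proj₂ generated (generator∈span (generators a h k d) zero)

  balanced⇒∈S : ∀ {n t} → Balanced k n t → combination a h d n t ∈ S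
  balanced⇒∈S {n} = combination∈ a h k d generator∈S n
    where
    generator∈S : ∀ {i} → 1 ≤ i → i ≤ k → + a ℤ.* + h ℤ.+ + i ℤ.* d ∈ S
    generator∈S {suc j} _ j<k =
      subst S (generators-suc a h d j<k) (proj₂ generated (generator∈span (generators a h k d) (suc (fromℕ< j<k))))

  ∈S⇒balanced : ∀ {s} → s ∈ S → ∃[ c ] ∃[ n ] ∃[ t ]
    (Balanced k n t × s ≡ + c ℤ.* + a ℤ.+ combination a h d n t)
  ∈S⇒balanced s∈S with c , s≡ ← proj₁ generated s∈S
    with n , t , balanced , eq ← sum-is-combination a h k d (c ∘ suc) (suc ∘ toℕ) (λ i → s≤s z≤n , toℕ<n i) =
    c zero , n , t , balanced , trans s≡ (cong (λ z → + c zero ℤ.* + a ℤ.+ z) eq)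

  -- If t - a were in S, then so would be s + (t - a) = (s + t) - a.
  Ap-summand : ∀ {s t} → s ∈ S → t ∈ S → s ℤ.+ t ∈ Ap S (+ a) → t ∈ Ap S (+ a)
  Ap-summand {s} {t} s∈S t∈S (_ , s+t-a∉S) =
    t∈S , λ t-a∈S → s+t-a∉S (subst S (sym (ℤ.+-assoc s t _)) (+-closed s∈S t-a∈S))

  -- Removing one a leaves z - 1 ≥ 0 copies of it, so the difference stays in S. The coefficient z
  -- is an integer because it will also be of the form eh + d, where d may be negative.
  positive-multiple∉Ap : ∀ {n t z} → Balanced k n t → 0ℤ ℤ.< z →
                         z ℤ.* + a ℤ.+ combination a h d n t ∉ Ap S (+ a)
  positive-multiple∉Ap {z = + suc c} balanced _ (_ , ∉S) = ∉S
    (subst S (identity (+ c) (+ a) _) (+-closed (multiple∈ c a∈S) (balanced⇒∈S balanced)))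
    where
    identity : ∀ c a z → c ℤ.* a ℤ.+ z ≡ ((1ℤ ℤ.+ c) ℤ.* a ℤ.+ z) ℤ.- a
    identity = solve-∀
  positive-multiple∉Ap {z = + zero} _ (ℤ.+<+ ())

  Ap⇒balanced : ∀ {b} → b ∈ Ap S (+ a) → ∃[ n ] ∃[ t ] (Balanced k n t × b ≡ combination a h d n t)
  Ap⇒balanced b∈Ap with ∈S⇒balanced (proj₁ b∈Ap)
  ... | zero  , n , t , balanced , b≡ = n , t , balanced , trans b≡ (ℤ.+-identityˡ _)
  ... | suc c , n , t , balanced , refl =
    contradiction b∈Ap (positive-multiple∉Ap {n} {t} {+ suc c} balanced (ℤ.+<+ (s≤s z≤n)))

  -- Otherwise m generators already reach the index sum t, and the spare ah amounts to h ≥ 1 copies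
  -- of a.
  Ap⇒pred[n]*k<t : ∀ {m t} → Balanced k (suc m) t → combination a h d (suc m) t ∈ Ap S (+ a) →
                   m * k < t
  Ap⇒pred[n]*k<t {m} {t} (m<t , _) ∈Ap = ≰⇒> λ t≤mk →
    positive-multiple∉Ap {m} {t} {+ h} (<⇒≤ m<t , t≤mk) (ℤ.+<+ 1≤h)
      (subst (Ap S (+ a)) (identity (+ a) (+ h) d (+ m) (+ t)) ∈Ap)
    where
    identity : ∀ a h d m t → (1ℤ ℤ.+ m) ℤ.* (a ℤ.* h) ℤ.+ t ℤ.* d ≡
               h ℤ.* a ℤ.+ (m ℤ.* (a ℤ.* h) ℤ.+ t ℤ.* d)
    identity = solve-∀

  0<ah+kd : 0ℤ ℤ.< + a ℤ.* + h ℤ.+ + k ℤ.* d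
  0<ah+kd = ℤ.≤-<-trans (ℤ.+≤+ z≤n) a<ah+kd

  Ap⇒t<a : ∀ {n t} → Balanced k n t → combination a h d n t ∈ Ap S (+ a) → t < a
  Ap⇒t<a {n} {t} (n≤t , t≤nk) ∈Ap
    with e , ek≤a , 0<eh+d ← ∃-exchange a h k d q r r<k a≡ 0<ah+kd minimal =
    ≰⇒> λ a≤t →
      -- For t ≥ a, keep n′ generators with index sum t - a; what is left over is ((n - n′)h + d)a.
      -- The bound n′ ≤ n - e makes this coefficient positive, and n′ ≤ t - a is half of
      -- balancedness. The other half, t - a ≤ n′k, holds for both terms of the minimum: t - a ≤ nk
      -- - ek and t - a ≤ (t - a)k.
      let n′ = (n ∸ e) ⊓ (t ∸ a)
          n′≤n∸e = m⊓n≤m (n ∸ e) (t ∸ a)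
          e≤n = *-cancelʳ-≤ e n k (≤-trans ek≤a (≤-trans a≤t t≤nk))
          n′≤n = ≤-trans n′≤n∸e (m∸n≤m n e)
          e≤n∸n′ = ≤-trans (≤-reflexive (sym (m∸[m∸n]≡n e≤n))) (∸-monoʳ-≤ n n′≤n∸e)
          t∸a≤[n∸e]k = ≤-trans (∸-mono t≤nk ek≤a) (≤-reflexive (sym (*-distribʳ-∸ k n e)))
          t∸a≤n′k = ≤-trans (⊓-glb t∸a≤[n∸e]k (m≤m*n (t ∸ a) k))
                            (≤-reflexive (sym (*-distribʳ-⊓ k (n ∸ e) (t ∸ a))))
      in positive-multiple∉Ap {n′} {t ∸ a} {+ (n ∸ n′) ℤ.* + h ℤ.+ d}
           (m⊓n≤n (n ∸ e) (t ∸ a) , t∸a≤n′k)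
           (ℤ.<-≤-trans 0<eh+d (ℤ.+-monoˡ-≤ d (ℤ.*-monoʳ-≤-nonNeg (+ h) (ℤ.+≤+ e≤n∸n′))))
           (subst (Ap S (+ a))
             (trans (sym (cong₂ (combination a h d) (m∸n+n≡m n′≤n) (m∸n+n≡m a≤t)))
                    (identity (+ a) (+ h) d (+ (n ∸ n′)) (+ n′) (+ (t ∸ a)))) ∈Ap)
    where
    identity : ∀ a h d e n t → (e ℤ.+ n) ℤ.* (a ℤ.* h) ℤ.+ (t ℤ.+ a) ℤ.* d ≡
               (e ℤ.* h ℤ.+ d) ℤ.* a ℤ.+ (n ℤ.* (a ℤ.* h) ℤ.+ t ℤ.* d)
    identity = solve-∀

  -- For b ≠ 0 at least one generator occurs, so x = n and y = t - (n - 1)k. Then y ≥ 1 because (n -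
  -- 1)k < t, y ≤ k because t ≤ nk, and t < a puts (x , y) in range.
  Ap⇒value : ∀ b → b ∈ Ap S (+ a) → b ≢ 0ℤ →
             ∃[ x ] ∃[ y ] (InRange k q r x y × b ≡ value a h k d x y)
  Ap⇒value b b∈Ap b≢0 with Ap⇒balanced b∈Ap
  ... | zero  , .0 , (_ , z≤n) , b≡ = contradiction b≡ b≢0
  ... | suc m , t , balanced@(_ , t≤k+mk) , refl = suc m , t ∸ m * k ,
    InRange⇐ a≡ r<k (m<n⇒0<n∸m mk<t)
      (m≤n+o⇒m∸n≤o t (m * k) (≤-trans t≤k+mk (≤-reflexive (+-comm k (m * k)))))
      (subst (_< a) (sym mk+y≡t) (Ap⇒t<a balanced b∈Ap)) ,
    sym (trans (value≡combination a h k d m (t ∸ m * k)) (cong (combination a h d (suc m)) mk+y≡t))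
    where
    mk<t : m * k < t
    mk<t = Ap⇒pred[n]*k<t balanced b∈Ap
    mk+y≡t : m * k + (t ∸ m * k) ≡ t
    mk+y≡t = m+[n∸m]≡n (<⇒≤ mk<t)

  -- The Apéry order in coordinates

  index-balanced : ∀ {m y} → 1 ≤ y → y ≤ k → Balanced k (suc m) (m * k + y)
  index-balanced {m} {y} 1≤y y≤k =
    ≤-trans (≤-reflexive (+-comm 1 m)) (+-mono-≤ (m≤m*n m k) 1≤y) ,
    ≤-trans (+-monoʳ-≤ (m * k) y≤k) (≤-reflexive (+-comm (m * k) k))

  value∈S : ∀ {x y} → InRange k q r x y → value a h k d x y ∈ S
  value∈S {y = y} range with m , refl , 1≤y , y≤k , _ ← InRange⇒ a≡ r<k range =
    subst S (sym (value≡combination a h k d m y)) (balanced⇒∈S (index-balanced {m} 1≤y y≤k))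

  -- The difference has x′ - x generators and index sum (x′ - x)k - (y - y′). This is balanced since
  -- 0 ≤ y - y′ ≤ k - 1.
  ≺-intro : ∀ {x y x′ y′} → InRange k q r x y → InRange k q r x′ y′ → x < x′ → y ≥ y′ →
            S ⊢ value a h k d x y ≺ value a h k d x′ y′
  ≺-intro {y = y} {y′ = y′} range range′ x<x′ y≥y′
    with m , refl , 1≤y , y≤k , t<a ← InRange⇒ a≡ r<k range
       | m′ , refl , 1≤y′ , y′≤k , t′<a ← InRange⇒ a≡ r<k range′
    with p , refl ← m≤n⇒∃[o]m+o≡n x<x′
       | w , refl ← m≤n⇒∃[o]m+o≡n y≥y′
    -- Here x′ - x = p + 1, w = y - y′ and v = k - 1 - w, which exists because y′ ≥ 1. The index sum
    -- (p + 1)k - w is then `suc u` with u = v + pk.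
    with v , w+v≡k ← m≤n⇒∃[o]m+o≡n {suc w} (≤-trans (+-monoˡ-≤ w 1≤y′) y≤k) =
    subst S (sym difference≡) (balanced⇒∈S (s≤s n≤u , +-monoˡ-≤ (p * k) 1+v≤k)) ,
    λ eq → <⇒≢ x<x′ (proj₁ (combination-injective 1≤a 1≤h coprime (suc m) (suc m′) t<a t′<a
      (trans (sym (value≡combination a h k d m y)) (trans eq (value≡combination a h k d m′ y′)))))
    where
    u : ℕ
    u = v + p * k
    n≤u : p ≤ u
    n≤u = ≤-trans (m≤m*n p k) (m≤n+m (p * k) v)
    1+v≤k : suc v ≤ k
    1+v≤k = ≤-trans (s≤s (m≤n+m v w)) (≤-reflexive w+v≡k)
    t+u≡t′ : (m * k + y) + suc u ≡ m′ * k + y′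
    t+u≡t′ = trans (ℕ-identity (m * k) (p * k) y′ w v)
      (trans (cong (λ z → z + (m * k + p * k) + y′) w+v≡k)
             (cong (λ z → k + z + y′) (sym (*-distribʳ-+ k m p))))
      where
      ℕ-identity : ∀ mk pk y′ w v → (mk + (y′ + w)) + suc (v + pk) ≡ (suc w + v) + (mk + pk) + y′
      ℕ-identity = ℕ-Solver.solve-∀
    identity : ∀ x y → (x ℤ.+ y) ℤ.- x ≡ y
    identity = solve-∀
    difference≡ : value a h k d (suc m′) y′ ℤ.- value a h k d (suc m) y ≡ combination a h d (suc p) (suc u)
    difference≡ = begin
      value a h k d (suc m′) y′ ℤ.- value a h k d (suc m) y
        ≡⟨ cong₂ ℤ._-_ (value≡combination a h k d m′ y′) (value≡combination a h k d m y) ⟩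
      combination a h d (suc m′) (m′ * k + y′) ℤ.- combination a h d (suc m) (m * k + y)
        ≡⟨ cong₂ (λ n t → combination a h d n t ℤ.- combination a h d (suc m) (m * k + y))
             (+-suc (suc m) p) t+u≡t′ ⟨
      combination a h d (suc m + suc p) ((m * k + y) + suc u) ℤ.- combination a h d (suc m) (m * k + y)
        ≡⟨ cong (ℤ._- combination a h d (suc m) (m * k + y))
             (combination-+ a h d (suc m) (m * k + y) (suc p) (suc u)) ⟩
      (combination a h d (suc m) (m * k + y) ℤ.+ combination a h d (suc p) (suc u))
        ℤ.- combination a h d (suc m) (m * k + y)
        ≡⟨ identity (combination a h d (suc m) (m * k + y)) _ ⟩
      combination a h d (suc p) (suc u) ∎
      where open ≡-Reasoning

  +-difference : ∀ x y → x ℤ.+ (y ℤ.- x) ≡ y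
  +-difference = solve-∀

  -- The difference is a summand of an Apéry element, so it is a balanced combination without copies
  -- of a. By uniqueness its coordinates add to those of the smaller element: x′ = x + n and t′ = t
  -- + u with u ≤ nk, whence y′ ≤ y.
  ≺-elim : ∀ {x y x′ y′} → InRange k q r x y → InRange k q r x′ y′ →
           value a h k d x′ y′ ∈ Ap S (+ a) →
           S ⊢ value a h k d x y ≺ value a h k d x′ y′ → x < x′ × y ≥ y′
  ≺-elim {x} {y} {x′} {y′} range range′ v′∈Ap (v′-v∈S , v≢v′)
    with m , refl , 1≤y , y≤k , t<a ← InRange⇒ a≡ r<k range
       | m′ , refl , 1≤y′ , y′≤k , t′<a ← InRange⇒ a≡ r<k range′
    with Ap⇒balanced (Ap-summand (value∈S range) v′-v∈S
           (subst (Ap S (+ a)) (sym (+-difference (value a h k d x y) (value a h k d x′ y′))) v′∈Ap))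
  ... | zero  , .0 , (_ , z≤n) , v′-v≡0 = contradiction (sym (ℤ.i-j≡0⇒i≡j _ _ v′-v≡0)) v≢v′
  ... | suc n , u , balanced@(_ , u≤nk) , v′-v≡
    with v′≡ ← trans (sym (+-difference (value a h k d (suc m) y) (value a h k d (suc m′) y′)))
           (trans (cong₂ ℤ._+_ (value≡combination a h k d m y) v′-v≡)
                  (sym (combination-+ a h d (suc m) (m * k + y) (suc n) u)))
    with refl , t′≡t+u ← combination-injective 1≤a 1≤h coprime (suc m′) (suc m + suc n) t′<a
      -- Uniqueness requires t + u < a; this holds because the sum of the two balanced combinations
      -- is the given Apéry element.
      (Ap⇒t<a {suc m + suc n} (balanced-+ (index-balanced {m} 1≤y y≤k) balanced) (subst (Ap S (+ a)) v′≡ v′∈Ap))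
      (trans (sym (value≡combination a h k d m′ y′)) v′≡) =
    s≤s (≤-trans (≤-reflexive (+-comm 1 m)) (+-monoʳ-≤ m (s≤s z≤n))) ,
    +-cancelˡ-≤ (m * k + suc n * k) y′ y (begin
      (m * k + suc n * k) + y′  ≡⟨ cong (_+ y′) (*-distribʳ-+ k m (suc n)) ⟨
      (m + suc n) * k + y′      ≡⟨ t′≡t+u ⟩
      (m * k + y) + u           ≤⟨ +-monoʳ-≤ (m * k + y) u≤nk ⟩
      (m * k + y) + suc n * k   ≡⟨ ℕ-identity (m * k) y (suc n * k) ⟩
      (m * k + suc n * k) + y   ∎)
    where
    open ≤-Reasoning
    ℕ-identity : ∀ m y n → (m + y) + n ≡ (m + n) + y
    ℕ-identity = ℕ-Solver.solve-∀

  -- The covering relation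

  nothing-between : ∀ {x y y′} → InRange k q r x y → InRange k q r (x + 1) y′ →
    value a h k d (x + 1) y′ ∈ Ap S (+ a) → value a h k d x y ≢ 0ℤ →
    ∀ {p} → p ∈ Ap S (+ a) → S ⊢ value a h k d x y ≺ p → ¬ (S ⊢ p ≺ value a h k d (x + 1) y′)
  nothing-between {x} {y} {y′} range range′ v′∈Ap v≢0 {p} p∈Ap v≺p p≺v′
    with Ap⇒value p p∈Ap p≢0
    where
    p≢0 : p ≢ 0ℤ
    -- Below p = 0 there is only 0, since S is non-negative. So p has coordinates by `Ap⇒value`, and
    -- its x would lie strictly between x and x + 1.
    p≢0 refl = v≢0 (ℤ.≤-antisym (ℤ.0≤i-j⇒j≤i (nonNegative (proj₁ v≺p))) (nonNegative (value∈S range)))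
  ... | x″ , y″ , range″ , refl = <⇒≱
    (proj₁ (≺-elim range range″ p∈Ap v≺p))
    (m<1+n⇒m≤n (subst (x″ <_) (+-comm x 1) (proj₁ (≺-elim range″ range′ v′∈Ap p≺v′))))

  -- Raising x by one and keeping y gives an intermediate element. It is in range because x + 1 < x′
  -- ≤ q + 1 gives x + 1 ≤ q, where every y up to k is allowed, and it is in the Apéry set as a
  -- summand of the larger element.
  between : ∀ {x y x′ y′} → InRange k q r x y → InRange k q r x′ y′ →
    value a h k d x′ y′ ∈ Ap S (+ a) → x + 1 < x′ → y ≥ y′ →
    ∃[ p ] (p ∈ Ap S (+ a) × S ⊢ value a h k d x y ≺ p × S ⊢ p ≺ value a h k d x′ y′)
  between {x} {y} {x′} {y′} range range′ v′∈Ap x+1<x′ y≥y′ =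
    value a h k d (x + 1) y ,
    Ap-summand (proj₁ p≺v′) (value∈S range″)
      (subst (Ap S (+ a)) (trans (sym (+-difference (value a h k d (x + 1) y) (value a h k d x′ y′)))
                                 (ℤ.+-comm (value a h k d (x + 1) y) _)) v′∈Ap) ,
    ≺-intro range range″ (m<m+n x (s≤s z≤n)) ≤-refl , p≺v′
    where
    x′≤q+1 : InRange k q r x′ y′ → x′ ≤ q + 1
    x′≤q+1 (inj₁ ((_ , x′≤q) , _)) = m≤n⇒m≤n+o 1 x′≤q
    x′≤q+1 (inj₂ (x′≡q+1 , _)) = ≤-reflexive x′≡q+1
    range″ : InRange k q r (x + 1) y
    range″ with _ , _ , 1≤y , y≤k , _ ← InRange⇒ a≡ r<k range =
      inj₁ ((m≤n+m 1 x , m<1+n⇒m≤n (subst (x + 1 <_) (+-comm q 1) (<-≤-trans x+1<x′ (x′≤q+1 range′)))) ,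
            1≤y , y≤k)
    p≺v′ : S ⊢ value a h k d (x + 1) y ≺ value a h k d x′ y′
    p≺v′ = ≺-intro range″ range′ x+1<x′ y≥y′

  ≺⇔ : ∀ {x y x′ y′} → InRange k q r x y → InRange k q r x′ y′ → value a h k d x′ y′ ∈ Ap S (+ a) →
    (S ⊢ value a h k d x y ≺ value a h k d x′ y′) ⇔ (x < x′ × y ≥ y′)
  ≺⇔ range range′ v′∈Ap =
    mk⇔ (≺-elim range range′ v′∈Ap) λ (x<x′ , y≥y′) → ≺-intro range range′ x<x′ y≥y′

  covers⇔ : ∀ {x y x′ y′} → InRange k q r x y → InRange k q r x′ y′ →
    value a h k d x′ y′ ∈ Ap S (+ a) → value a h k d x y ≢ 0ℤ →
    Covers (Ap S (+ a)) (S ⊢_≺_) (value a h k d x′ y′) (value a h k d x y) ⇔ (x′ ≡ x + 1 × y ≥ y′)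
  covers⇔ {x} {y} {x′} {y′} range range′ v′∈Ap v≢0 = mk⇔ to from
    where
    to : _ → x′ ≡ x + 1 × y ≥ y′
    to (v≺v′ , none) with x<x′ , y≥y′ ← ≺-elim range range′ v′∈Ap v≺v′
      with m≤n⇒m<n∨m≡n (subst (_≤ x′) (+-comm 1 x) x<x′)
    ... | inj₁ x+1<x′ = contradiction (between range range′ v′∈Ap x+1<x′ y≥y′) none
    ... | inj₂ x+1≡x′ = sym x+1≡x′ , y≥y′
    from : x′ ≡ x + 1 × y ≥ y′ → _
    from (refl , y≥y′) = ≺-intro range range′ (m<m+n x (s≤s z≤n)) y≥y′ ,
      λ (p , p∈Ap , v≺p , p≺v′) → nothing-between range range′ v′∈Ap v≢0 p∈Ap v≺p p≺v′

theorem3p4 : (S : Pred ℤ 0ℓ) (a h k : ℕ) (d : ℤ) →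
    IsExtraGeneralizedArithmetical S a h k d →
    AreMinimalGenerators (generators a h k d) →
    (q r : ℕ) → a ∸ 1 ≡ q * k + r → r < k →
    (∀ b → b ∈ Ap S (+ a) → b ≢ 0ℤ →
    ∃[ x ] ∃[ y ] (InRange k q r x y × b ≡ value a h k d x y))
    ×
    (∀ b b′ x y x′ y′ →
    b ∈ Ap S (+ a) → b ≢ 0ℤ → InRange k q r x y → b ≡ value a h k d x y →
    b′ ∈ Ap S (+ a) → b′ ≢ 0ℤ → InRange k q r x′ y′ → b′ ≡ value a h k d x′ y′ →
    (S ⊢ b ≺ b′) ⇔ (x < x′ × y ≥ y′))
    ×
    (∀ b b′ x y x′ y′ →
    b ∈ Ap S (+ a) → b ≢ 0ℤ → InRange k q r x y → b ≡ value a h k d x y →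
    b′ ∈ Ap S (+ a) → b′ ≢ 0ℤ → InRange k q r x′ y′ → b′ ≡ value a h k d x′ y′ →
    Covers (Ap S (+ a)) (S ⊢_≺_) b′ b ⇔ (x′ ≡ x + 1 × y ≥ y′))
theorem3p4 S a h k d extra minimal q r a∸1≡qk+r r<k =
  Ap⇒value ,
  (λ { _ _ _ _ _ _ _ _ range refl v′∈Ap _ range′ refl → ≺⇔ range range′ v′∈Ap }) ,
  (λ { _ _ _ _ _ _ _ v≢0 range refl v′∈Ap _ range′ refl → covers⇔ range range′ v′∈Ap v≢0 })
  where
  open IsExtraGeneralizedArithmetical extra using (1≤a)
  a≡ : a ≡ suc (q * k + r)
  a≡ = trans (sym (m+[n∸m]≡n 1≤a)) (cong suc a∸1≡qk+r)
  open ApéryPoset S a h k d extra minimal q r a≡ r<k
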